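{- Let $R(q)=\dfrac{(q;q^5)_\infty(q^4;q^5)_\infty}{(q^2;q^5)_\infty(q^3;q^5)_\infty}$ and define the coefficients $B(n)$, $n\ge 0$, by the power series expansion $$R^5(q)=\sum_{n=0}^{\infty}B(n)q^n,\qquad |q|<1.$$ Then $B(0)>0$ and $B(5)<0$.
   Context: For complex numbers $a,q$ with $|q|<1$, $(a;q)_\infty:=\prod_{k=0}^{\infty}(1-aq^k)$. The function $R(q)$ is the Rogers-Ramanujan continued fraction without its factor $q^{1/5}$, i.e. $R(q)=\cfrac{1}{1+\cfrac{q}{1+\cfrac{q^2}{1+\cfrac{q^3}{1+\cdots}}}}$, which equals the infinite product $\dfrac{(q;q^5)_\infty(q^4;q^5)_\infty}{(q^2;q^5)_\infty(q^3;q^5)_\infty}$ (a classical identity of Rogers and Ramanujan). Here $R^5(q)$ denotes $(R(q))^5$. -}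

module Defs where

open import Algebra.Bundles using (Semiring)
open import Data.Fin.Base using (Fin; zero; suc; toℕ)
open import Data.Fin.Properties using (toℕ≤pred[n])
open import Data.Integer.Base using (ℤ; 0ℤ; 1ℤ; _+_; _-_; -_; _*_)
open import Data.Integer.Properties as ℤ using ()
open import Data.Nat.Base as ℕ using (ℕ; zero; suc; _∸_; _≤_; _<_; s≤s; z≤n)
open import Data.Nat.Induction using (<-rec; <-wellFounded)
open import Data.Nat.Properties as ℕ using ()
open import Data.Product.Base using (∃-syntax; _,_)
open import Function.Base using (_∘_)
open import Induction.WellFounded using (module FixPoint)
open import Relation.Binary.PropositionalEquality
  using (_≡_; _≗_; refl; sym; trans; cong; cong₂; module ≡-Reasoning)
open import Relation.Nullary.Decidable.Core using (yes; no)

open import Algebra.Properties.Monoid.Sum (Semiring.+-monoid ℤ.+-*-semiring)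
  using (sum-syntax; sum⁺-syntax; sum-cong-≗)

-- The formal power series  Σₙ f(n) qⁿ  in ℤ[[q]] is represented by its
-- coefficient function f.  Every series occurring here has integer
-- coefficients, and a quotient by a series with constant term 1 is the same
-- in ℤ[[q]] as in ℂ[[q]].
Series : Set
Series = ℕ → ℤ

infixl 6 _-ˢ_
infixl 7 _*ˢ_ _/ˢ_
infixr 8 _^ˢ_

1ˢ : Series
1ˢ zero    = 1ℤ
1ˢ (suc _) = 0ℤ

q : Series
q zero          = 0ℤ
q (suc zero)    = 1ℤ
q (suc (suc _)) = 0ℤ

_-ˢ_ : Series → Series → Series
(f -ˢ g) n = f n - g n

_*ˢ_ : Series → Series → Series
(f *ˢ g) n = ∑[ i ≤ n ] (f (toℕ i) * g (n ∸ toℕ i))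

_^ˢ_ : Series → ℕ → Series
f ^ˢ zero  = 1ˢ
f ^ˢ suc k = f *ˢ f ^ˢ k

-- Long division.  It yields the quotient of f by g only when g has constant
-- term 1; see *ˢ-/ˢ.
divStep : Series → Series → ∀ n → (∀ {m} → m < n → ℤ) → ℤ
divStep f g zero    rec = f 0
divStep f g (suc n) rec =
  f (suc n) - ∑[ i ≤ n ] (g (suc (toℕ i)) * rec (s≤s (ℕ.m∸n≤m n (toℕ i))))

_/ˢ_ : Series → Series → Series
f /ˢ g = <-rec _ (divStep f g)

partialPochhammer : Series → Series → ℕ → Series
partialPochhammer a x zero    = 1ˢ
partialPochhammer a x (suc K) = partialPochhammer a x K *ˢ (1ˢ -ˢ a *ˢ x ^ˢ K)

-- (a;x)_∞ = ∏_{k≥0} (1 - a xᵏ), for x without constant term.  The factors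
-- with k > n do not affect the coefficient of qⁿ, which is therefore read off
-- from the product over k ≤ n; pochhammer-limit shows that this is the limit
-- of the partial products.
⟨_⨾_⟩∞ : Series → Series → Series
⟨ a ⨾ x ⟩∞ n = partialPochhammer a x (suc n) n

-- Convergence in the q-adic topology: each coefficient is eventually constant.
_⟶_ : (ℕ → Series) → Series → Set
s ⟶ f = ∀ n → ∃[ K ] (∀ k → K ≤ k → s k n ≡ f n)

numerator denominator R B : Series
numerator   = ⟨ q ⨾ q ^ˢ 5 ⟩∞ *ˢ ⟨ q ^ˢ 4 ⨾ q ^ˢ 5 ⟩∞
denominator = ⟨ q ^ˢ 2 ⨾ q ^ˢ 5 ⟩∞ *ˢ ⟨ q ^ˢ 3 ⨾ q ^ˢ 5 ⟩∞
R = numerator /ˢ denominator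
B = R ^ˢ 5

/ˢ-unfold : ∀ f g n →
  (f /ˢ g) n ≡ divStep f g n (λ {m} _ → (f /ˢ g) m)
/ˢ-unfold f g n =
  FixPoint.unfold-wfRec <-wellFounded (λ _ → ℤ) (divStep f g) ext {n}
  where
  ext : ∀ n {r r′ : ∀ {m} → m < n → ℤ} →
        (∀ {m} (m<n : m < n) → r m<n ≡ r′ m<n) →
        divStep f g n r ≡ divStep f g n r′
  ext zero    eq = refl
  ext (suc n) eq = cong (λ s → f (suc n) - s)
    (sum-cong-≗ {suc n} λ i → cong (g (suc (toℕ i)) *_) (eq (s≤s (ℕ.m∸n≤m n (toℕ i)))))

*ˢ-/ˢ : ∀ f g → g 0 ≡ 1ℤ → g *ˢ (f /ˢ g) ≗ f
*ˢ-/ˢ f g g₀≡1 zero = begin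
  g 0 * f 0 + 0ℤ  ≡⟨ ℤ.+-identityʳ _ ⟩
  g 0 * f 0       ≡⟨ cong (_* f 0) g₀≡1 ⟩
  1ℤ * f 0        ≡⟨ ℤ.*-identityˡ _ ⟩
  f 0             ∎
  where open ≡-Reasoning
*ˢ-/ˢ f g g₀≡1 (suc n) = begin
  g 0 * h (suc n) + S      ≡⟨ cong (λ c → c * h (suc n) + S) g₀≡1 ⟩
  1ℤ * h (suc n) + S       ≡⟨ cong (_+ S) (ℤ.*-identityˡ (h (suc n))) ⟩
  h (suc n) + S            ≡⟨ cong (_+ S) (/ˢ-unfold f g (suc n)) ⟩
  f (suc n) - S + S        ≡⟨ ℤ.+-assoc (f (suc n)) (- S) S ⟩
  f (suc n) + (- S + S)    ≡⟨ cong (λ c → f (suc n) + c) (ℤ.+-inverseˡ S) ⟩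
  f (suc n) + 0ℤ           ≡⟨ ℤ.+-identityʳ _ ⟩
  f (suc n)                ∎
  where
  open ≡-Reasoning
  h = f /ˢ g
  S = ∑[ i ≤ n ] (g (suc (toℕ i)) * h (n ∸ toℕ i))

denominator*R : denominator *ˢ R ≗ numerator
denominator*R = *ˢ-/ˢ numerator denominator refl

∑-zero : ∀ n (t : Fin n → ℤ) → (∀ i → t i ≡ 0ℤ) → ∑[ i < n ] t i ≡ 0ℤ
∑-zero zero    t t≡0 = refl
∑-zero (suc n) t t≡0 = cong₂ _+_ (t≡0 zero) (∑-zero n (t ∘ suc) (t≡0 ∘ suc))

*ˢ-identityʳ : ∀ f → f *ˢ 1ˢ ≗ f
*ˢ-identityʳ f zero    = trans (ℤ.+-identityʳ _) (ℤ.*-identityʳ (f 0))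
*ˢ-identityʳ f (suc n) =
  trans (cong₂ _+_ (ℤ.*-zeroʳ (f 0)) (*ˢ-identityʳ (f ∘ suc) n)) (ℤ.+-identityˡ _)

VanishesBelow : ℕ → Series → Set
VanishesBelow k f = ∀ n → n < k → f n ≡ 0ℤ

*ˢ-vanishes : ∀ {j k f g} → VanishesBelow j f → VanishesBelow k g →
              VanishesBelow (j ℕ.+ k) (f *ˢ g)
*ˢ-vanishes {j} {k} {f} {g} f≡0 g≡0 n n<j+k = ∑-zero (suc n) _ term
  where
  term : ∀ i → f (toℕ i) * g (n ∸ toℕ i) ≡ 0ℤ
  term i with toℕ i ℕ.<? j
  ... | yes i<j = cong (_* g (n ∸ toℕ i)) (f≡0 _ i<j)
  ... | no  i≮j = trans (cong (f (toℕ i) *_) (g≡0 _ n∸i<k)) (ℤ.*-zeroʳ (f (toℕ i)))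
    where
    open ℕ.≤-Reasoning
    n∸i<k : n ∸ toℕ i < k
    n∸i<k = ℕ.+-cancelˡ-< (toℕ i) _ _ (begin-strict
      toℕ i ℕ.+ (n ∸ toℕ i)  ≡⟨ ℕ.m+[n∸m]≡n (toℕ≤pred[n] i) ⟩
      n                      <⟨ n<j+k ⟩
      j ℕ.+ k                ≤⟨ ℕ.+-monoˡ-≤ k (ℕ.≮⇒≥ i≮j) ⟩
      toℕ i ℕ.+ k            ∎)

^ˢ-vanishes : ∀ {x} → x 0 ≡ 0ℤ → ∀ k → VanishesBelow k (x ^ˢ k)
^ˢ-vanishes     x₀≡0 zero    _ ()
^ˢ-vanishes {x} x₀≡0 (suc k) =
  *ˢ-vanishes {f = x} (λ { zero _ → x₀≡0 ; (suc _) (s≤s ()) }) (^ˢ-vanishes x₀≡0 k)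

partialPochhammer-step : ∀ a x → x 0 ≡ 0ℤ → ∀ K n → n < K →
  partialPochhammer a x (suc K) n ≡ partialPochhammer a x K n
partialPochhammer-step a x x₀≡0 K n n<K =
  trans (sum-cong-≗ {suc n} λ i → cong (P (toℕ i) *_) (factor (n ∸ toℕ i)
          (ℕ.≤-<-trans (ℕ.m∸n≤m n (toℕ i)) n<K)))
        (*ˢ-identityʳ P n)
  where
  P = partialPochhammer a x K
  factor : ∀ m → m < K → (1ˢ -ˢ a *ˢ x ^ˢ K) m ≡ 1ˢ m
  factor m m<K =
    trans (cong (λ c → 1ˢ m - c)
            (*ˢ-vanishes {0} {f = a} (λ _ ()) (^ˢ-vanishes x₀≡0 K) m m<K))
          (ℤ.+-identityʳ (1ˢ m))

pochhammer-limit : ∀ a x → x 0 ≡ 0ℤ → partialPochhammer a x ⟶ ⟨ a ⨾ x ⟩∞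
pochhammer-limit a x x₀≡0 n = suc n , λ k n<k → go (ℕ.≤⇒≤′ n<k)
  where
  go : ∀ {k} → suc n ℕ.≤′ k → partialPochhammer a x k n ≡ ⟨ a ⨾ x ⟩∞ n
  go (ℕ.≤′-reflexive refl) = refl
  go (ℕ.≤′-step n<k)       =
    trans (partialPochhammer-step a x x₀≡0 _ n (ℕ.≤′⇒≤ n<k)) (go n<k)

-- Modulo q⁶ each of the four infinite products reduces to its first factor, so
-- (1 - q²)(1 - q³) R ≡ (1 - q)(1 - q⁴).  Series with constant term 1 can be
-- cancelled, whence R ≡ 1 - q + q² - q⁴ + q⁵ and
-- R⁵ ≡ 1 - 5q + 15q² - 30q³ + 40q⁴ - 26q⁵.

module Submission where

open import Defs
open import Algebra.Bundles using (AbelianGroup; Semiring)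
open import Data.Fin.Base using (toℕ)
open import Data.Fin.Properties using (toℕ≤pred[n])
open import Data.Integer.Base using (ℤ; _<_; _>_; 0ℤ; 1ℤ; -1ℤ; +<+; -<+; _+_; _-_; _*_)
open import Data.Integer.Properties as ℤ using ()
open import Data.List.Base using (List; []; _∷_)
open import Data.Nat.Base as ℕ using (ℕ; zero; suc; _∸_; s≤s; z<s)
open import Data.Nat.Induction using (<-rec)
open import Data.Nat.Properties as ℕ using ()
open import Data.Product.Base using (_×_; _,_)
open import Relation.Binary.PropositionalEquality
  using (_≡_; refl; sym; trans; cong; cong₂; subst; module ≡-Reasoning)
open import Relation.Nullary.Decidable using (from-yes)

open import Algebra.Properties.Monoid.Sum (Semiring.+-monoid ℤ.+-*-semiring)
  using (sum-syntax; sum⁺-syntax; sum-cong-≗)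
open import Algebra.Properties.Group (AbelianGroup.group ℤ.+-0-abelianGroup)
  using () renaming (∙-cancelʳ to +-cancelʳ)

infix 4 _≡_[mod-q^_]

-- Wrapping the coefficientwise condition in a record keeps `f`, `g` and `N` visible in the type, so
-- that they can usually be inferred.
record _≡_[mod-q^_] (f g : Series) (N : ℕ) : Set where
  constructor modq
  field coefficient : ∀ n → n ℕ.< N → f n ≡ g n

open _≡_[mod-q^_]

-- The `n`-th coefficient of a product reads only coefficients of index at most `n` of its factors.
*ˢ-cong : ∀ {N f f′ g g′} → f ≡ f′ [mod-q^ N ] → g ≡ g′ [mod-q^ N ] →
          f *ˢ g ≡ f′ *ˢ g′ [mod-q^ N ]
*ˢ-cong f≡f′ g≡g′ .coefficient n n<N = sum-cong-≗ {suc n} λ i → cong₂ _*_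
  (f≡f′ .coefficient (toℕ i) (ℕ.≤-<-trans (toℕ≤pred[n] i) n<N))
  (g≡g′ .coefficient (n ∸ toℕ i) (ℕ.≤-<-trans (ℕ.m∸n≤m n (toℕ i)) n<N))

^ˢ-cong : ∀ {N f f′} k → f ≡ f′ [mod-q^ N ] → f ^ˢ k ≡ f′ ^ˢ k [mod-q^ N ]
^ˢ-cong zero    f≡f′ = modq λ _ _ → refl
^ˢ-cong (suc k) f≡f′ = *ˢ-cong f≡f′ (^ˢ-cong k f≡f′)

-- Strong induction on the index: as `g` has constant term 1, the `n`-th coefficient of `g *ˢ h` is
-- `h n` plus terms in earlier coefficients of `h`, which already agree.
*ˢ-cancelˡ : ∀ {N} g {h h′} → g 0 ≡ 1ℤ →
             g *ˢ h ≡ g *ˢ h′ [mod-q^ N ] → h ≡ h′ [mod-q^ N ]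
*ˢ-cancelˡ {N} g {h} {h′} g₀≡1 gh≡gh′ =
  modq (<-rec (λ n → n ℕ.< N → h n ≡ h′ n) step)
  where
  tail : Series → Series
  -- The convolution without its term `i = 0`; at index 0 nothing else remains.
  tail k zero    = 0ℤ
  tail k (suc n) = ∑[ i ≤ n ] (g (suc (toℕ i)) * k (n ∸ toℕ i))

  split : ∀ k n → (g *ˢ k) n ≡ k n + tail k n
  split k n = trans (unfold n) (cong (_+ tail k n)
    (trans (cong (_* k n) g₀≡1) (ℤ.*-identityˡ (k n))))
    where
    unfold : ∀ n → (g *ˢ k) n ≡ g 0 * k n + tail k n
    unfold zero    = refl
    unfold (suc n) = refl

  step : ∀ n → (∀ {m} → m ℕ.< n → m ℕ.< N → h m ≡ h′ m) → n ℕ.< N → h n ≡ h′ n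
  step n rec n<N = +-cancelʳ (tail h n) (h n) (h′ n) (begin
    h n + tail h n    ≡⟨ split h n ⟨
    (g *ˢ h) n        ≡⟨ gh≡gh′ .coefficient n n<N ⟩
    (g *ˢ h′) n       ≡⟨ split h′ n ⟩
    h′ n + tail h′ n  ≡⟨ cong (h′ n +_) (tail-cong n rec n<N) ⟨
    h′ n + tail h n   ∎)
    where
    open ≡-Reasoning
    tail-cong : ∀ n → (∀ {m} → m ℕ.< n → m ℕ.< N → h m ≡ h′ m) → n ℕ.< N →
                tail h n ≡ tail h′ n
    tail-cong zero    rec n<N = refl
    tail-cong (suc n) rec n<N = sum-cong-≗ {suc n} λ i →
      let n∸i<1+n = s≤s (ℕ.m∸n≤m n (toℕ i)) in
      cong (g (suc (toℕ i)) *_) (rec n∸i<1+n (ℕ.<-trans n∸i<1+n n<N))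

VanishesBelow-≤ : ∀ {j k} f → j ℕ.≤ k → VanishesBelow k f → VanishesBelow j f
VanishesBelow-≤ f j≤k f≡0 n n<j = f≡0 n (ℕ.<-≤-trans n<j j≤k)

1ˢ-vanishing : ∀ {N} f → VanishesBelow N f → 1ˢ -ˢ f ≡ 1ˢ [mod-q^ N ]
1ˢ-vanishing f f≡0 .coefficient n n<N =
  trans (cong (λ c → 1ˢ n - c) (f≡0 n n<N)) (ℤ.+-identityʳ (1ˢ n))

*ˢ-identityˡ : ∀ f n → (1ˢ *ˢ f) n ≡ f n
*ˢ-identityˡ f n = trans (cong₂ _+_ (ℤ.*-identityˡ (f n)) (∑-zero n _ λ i → refl))
                         (ℤ.+-identityʳ (f n))

-- Every factor after the first is 1 minus a multiple of `a *ˢ x`, whose order is at least `j + k`,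
-- hence is congruent to 1.
pochhammer-first-factor : ∀ {j k} a x → VanishesBelow j a → VanishesBelow k x →
                          x 0 ≡ 0ℤ → ⟨ a ⨾ x ⟩∞ ≡ 1ˢ -ˢ a [mod-q^ j ℕ.+ k ]
pochhammer-first-factor {j} {k} a x a≡0 x≡0 x₀≡0 =
  -- Coefficient `n` of the infinite product is by definition that of the partial product with
  -- `suc n` factors, so no limit is taken.
  modq λ n → partial n .coefficient n
  where
  x^-vanishes : ∀ K → VanishesBelow k (x ^ˢ suc K)
  x^-vanishes K = VanishesBelow-≤ (x ^ˢ suc K) (ℕ.m≤m+n k K)
    (*ˢ-vanishes {f = x} {x ^ˢ K} x≡0 (^ˢ-vanishes x₀≡0 K))

  partial : ∀ K → partialPochhammer a x (suc K) ≡ 1ˢ -ˢ a [mod-q^ j ℕ.+ k ]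
  partial zero    = modq λ n _ → trans (*ˢ-identityˡ (1ˢ -ˢ a *ˢ 1ˢ) n)
                                       (cong (λ c → 1ˢ n - c) (*ˢ-identityʳ a n))
  partial (suc K) = modq λ n n<j+k → trans
    (*ˢ-cong (partial K) (1ˢ-vanishing (a *ˢ x ^ˢ suc K)
      (*ˢ-vanishes {f = a} {x ^ˢ suc K} a≡0 (x^-vanishes K))) .coefficient n n<j+k)
    (*ˢ-identityʳ (1ˢ -ˢ a) n)

-- Here `a` has order at least 1 and the base has order 5; the modulus 1 + 5 just reaches the
-- coefficient of q⁵.
first-factor-base-q⁵ : ∀ a → a 0 ≡ 0ℤ → ⟨ a ⨾ q ^ˢ 5 ⟩∞ ≡ 1ˢ -ˢ a [mod-q^ 6 ]
first-factor-base-q⁵ a a₀≡0 = pochhammer-first-factor {1} {5} a (q ^ˢ 5)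
  (λ { zero _ → a₀≡0 ; (suc _) (s≤s ()) }) (^ˢ-vanishes {q} refl 5) refl

polynomial : List ℤ → Series
polynomial []       _       = 0ℤ
polynomial (c ∷ cs) zero    = c
polynomial (c ∷ cs) (suc n) = polynomial cs n

R₆ : Series
R₆ = polynomial (1ℤ ∷ -1ℤ ∷ 1ℤ ∷ 0ℤ ∷ -1ℤ ∷ 1ℤ ∷ [])

numerator₆ denominator₆ : Series
numerator₆   = (1ˢ -ˢ q) *ˢ (1ˢ -ˢ q ^ˢ 4)
denominator₆ = (1ˢ -ˢ q ^ˢ 2) *ˢ (1ˢ -ˢ q ^ˢ 3)

numerator≡ : numerator ≡ numerator₆ [mod-q^ 6 ]
numerator≡ = *ˢ-cong (first-factor-base-q⁵ q refl) (first-factor-base-q⁵ (q ^ˢ 4) refl)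

denominator≡ : denominator ≡ denominator₆ [mod-q^ 6 ]
denominator≡ =
  *ˢ-cong (first-factor-base-q⁵ (q ^ˢ 2) refl) (first-factor-base-q⁵ (q ^ˢ 3) refl)

denominator₆*R₆ : denominator₆ *ˢ R₆ ≡ numerator₆ [mod-q^ 6 ]
denominator₆*R₆ = modq λ n →
  -- Both sides are explicit, so the six coefficients are compared by evaluation.
  from-yes (ℕ.allUpTo? (λ n → (denominator₆ *ˢ R₆) n ℤ.≟ numerator₆ n) 6)

-- Multiplied by `denominator₆`, both series become `numerator₆` modulo q⁶; for `R` this comes from
-- the exact identity `denominator*R`.
R≡R₆ : R ≡ R₆ [mod-q^ 6 ]
R≡R₆ = *ˢ-cancelˡ denominator₆ refl (modq λ n n<6 → begin
  (denominator₆ *ˢ R) n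
    ≡⟨ *ˢ-cong {g = R} denominator≡ (modq λ _ _ → refl) .coefficient n n<6 ⟨
  (denominator *ˢ R) n
    ≡⟨ denominator*R n ⟩
  numerator n
    ≡⟨ numerator≡ .coefficient n n<6 ⟩
  numerator₆ n
    ≡⟨ denominator₆*R₆ .coefficient n n<6 ⟨
  (denominator₆ *ˢ R₆) n
    ∎)
  where open ≡-Reasoning

B≡R₆⁵ : B ≡ R₆ ^ˢ 5 [mod-q^ 6 ]
B≡R₆⁵ = ^ˢ-cong {f = R} {R₆} 5 R≡R₆

theorem1p7 : (B 0 > 0ℤ) × (B 5 < 0ℤ)
-- The coefficients of `R₆ ^ˢ 5` evaluate to 1 at index 0 and to -26 at index 5, so the sign is read
-- off from the integer constructors.
theorem1p7 = subst (_> 0ℤ) (sym (B≡R₆⁵ .coefficient 0 z<s)) (+<+ z<s)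
           , subst (_< 0ℤ) (sym (B≡R₆⁵ .coefficient 5 ℕ.≤-refl)) -<+
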